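{- Let $(S,A)$ be a computable physical model in which $A$ is a finite set. Then $(S,A)$ is isomorphic to some computable physical model whose observable quantities are all projection functions $\pi_i^{m}$ (for a suitable length $m$).
   Context: A computable physical model is a pair $(S,A)$ where $S$ (the set of states) is a recursive set of non-negative integers and $A$ (the set of observable quantities) is a set of total recursive functions from the non-negative integers to the non-negative integers. Two physical models $(S,A)$ and $(T,B)$ are isomorphic iff there exist bijections $\phi:S\to T$ and $\psi:A\to B$ such that $\alpha(s)=\psi(\alpha)(\phi(s))$ for all $s\in S$ and $\alpha\in A$. Sequences of non-negative integers are coded as non-negative integers via Cantor's pairing function $\langle x,y\rangle=\frac12(x^2+2xy+y^2+3x+y)$, with $\langle x_1,\dots,x_n\rangle=\langle\langle x_1,\dots,x_{n-1}\rangle,x_n\rangle$. The projection function $\pi_i^n$ ($1\le i\le n$) is defined by $\pi_i^n\langle x_1,\dots,x_n\rangle=x_i$. -}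

module Defs where

open import Data.Nat using (ℕ; zero; suc; _+_; _*_)
open import Data.Nat.DivMod using (_/_)
open import Data.Bool using (Bool; T)
open import Data.Fin using (Fin)
open import Data.Vec using (Vec; _∷_; toList; lookup)
open import Data.List using (foldl)
open import Data.Product using (Σ; ∃; _×_; proj₁)
open import Function.Bundles using (_⤖_; Bijection)
open import Relation.Binary.PropositionalEquality using (_≡_)

⟨_,_⟩ : ℕ → ℕ → ℕ
⟨ x , y ⟩ = (x * x + 2 * x * y + y * y + 3 * x + y) / 2

code : ∀ {k} → Vec ℕ (suc k) → ℕ
code (x ∷ xs) = foldl ⟨_,_⟩ x (toList xs)

-- b is the projection function π_i^m (m = suc k, i a 0-based index into the
-- sequence): π_i^m ⟨x₁,…,x_m⟩ = x_i.  Since the coding is onto ℕ this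
-- determines b as a total function.
IsProjection : (k : ℕ) → Fin (suc k) → (ℕ → ℕ) → Set
IsProjection k i b = (xs : Vec ℕ (suc k)) → b (code xs) ≡ lookup xs i

_≐_ : (ℕ → ℕ) → (ℕ → ℕ) → Set
f ≐ g = (x : ℕ) → f x ≡ g x

-- A computable physical model (S , A).
-- * S is a recursive set, given by its (computable) characteristic function.
-- * A is a set of (total, computable) functions ℕ → ℕ, presented as an
--   index type Obs together with an enumeration obs that is injective up to
--   extensional equality of functions (so distinct indices are distinct
--   functions, i.e. obs is a bijection Obs → A).
record Model : Set₁ where
  field
    S        : ℕ → Bool
    Obs      : Set
    obs      : Obs → ℕ → ℕ
    obs-inj  : (a b : Obs) → obs a ≐ obs b → a ≡ b

  State : Set
  State = Σ ℕ (λ s → T (S s))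

open Model public

FiniteObs : Model → Set
FiniteObs M = ∃ λ n → Obs M ⤖ Fin n

record _≅_ (M N : Model) : Set where
  field
    φ : State M ⤖ State N
    ψ : Obs M ⤖ Obs N
    compat : (α : Obs M) (s : State M) →
             obs M α (proj₁ s) ≡ obs N (Bijection.to ψ α) (proj₁ (Bijection.to φ s))

AllProjections : Model → Set
AllProjections N =
  ∃ λ k → (β : Obs N) → ∃ λ (i : Fin (suc k)) → IsProjection k i (obs N β)

module Submission where

-- Let A = {α₁,…,αₙ} be finite.  Send a state s to the code
-- ⟨s, α₁(s), …, αₙ(s)⟩ of the sequence "s followed by all its observed
-- values".  Then αᵢ(s) is read off the code by the projection π_{i+1}^{n+1},
-- and s itself by π_1^{n+1}, so the map is injective; the image model has
-- these codes as states and the projections π_{i+1}^{n+1} as observables.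

open import Defs
open import Data.Product using (∃; _×_; _,_; proj₁; proj₂; Σ)
open import Data.Product.Properties using (Σ-≡,≡→≡)
open import Data.Nat using (ℕ; zero; suc; _+_; _*_; _∸_; _≤_; _≡ᵇ_)
open import Data.Nat.Properties
  using (*-distribʳ-+; +-identityʳ; +-suc; ≤-refl; ≤-trans; n≤1+n; n∸n≡0;
         +-∸-assoc; m≤m+n; m+n∸m≡n; ≡ᵇ⇒≡; ≡⇒≡ᵇ)
open import Data.Nat.DivMod using (_/_; m*n/n≡m)
open import Data.Nat.Tactic.RingSolver using (solve-∀)
open import Data.Bool using (Bool; T; _∧_)
open import Data.Bool.Properties using (T-∧; T-irrelevant)
open import Data.Fin using (Fin; toℕ) renaming (zero to fzero; suc to fsuc)
open import Data.Fin.Properties using (toℕ-injective; suc-injective)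
open import Data.Vec using (Vec; _∷_; []; _∷ʳ_; toList; lookup; tabulate; initLast)
open import Data.Vec.Properties using (toList-∷ʳ; lookup∘tabulate)
open import Data.List using (foldl)
open import Data.List.Properties using (foldl-∷ʳ)
open import Function using (_∘_)
open import Function.Bundles using (_⤖_; Bijection; Inverse; Equivalence; mk↔ₛ′)
open import Function.Properties.Bijection using (⤖⇒↔)
open import Function.Properties.Inverse using (↔⇒⤖)
open import Relation.Binary.PropositionalEquality
  using (_≡_; refl; sym; trans; cong; module ≡-Reasoning)

tri : ℕ → ℕ
tri zero    = zero
tri (suc n) = tri n + suc n

-- Gauss' formula, in the division-free form 2·tri n = n(n+1).
tri-double : ∀ n → tri n * 2 ≡ n * suc n
tri-double zero    = refl
tri-double (suc n) = begin
  (tri n + suc n) * 2     ≡⟨ *-distribʳ-+ 2 (tri n) (suc n) ⟩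
  tri n * 2 + suc n * 2   ≡⟨ cong (_+ suc n * 2) (tri-double n) ⟩
  n * suc n + suc n * 2   ≡⟨ normalise n ⟩
  suc n * suc (suc n)     ∎
  where
  open ≡-Reasoning
  normalise : ∀ n → n * suc n + suc n * 2 ≡ suc n * suc (suc n)
  normalise = solve-∀

-- Cantor's pairing counts along anti-diagonals: ⟨x,y⟩ = tri(x+y) + x.
pair-tri : ∀ x y → ⟨ x , y ⟩ ≡ tri (x + y) + x
pair-tri x y = begin
  (x * x + 2 * x * y + y * y + 3 * x + y) / 2 ≡⟨ cong (_/ 2) (sym doubled) ⟩
  (tri (x + y) + x) * 2 / 2                   ≡⟨ m*n/n≡m (tri (x + y) + x) 2 ⟩
  tri (x + y) + x                             ∎
  where
  open ≡-Reasoning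
  normalise : ∀ x y → (x + y) * suc (x + y) + x * 2 ≡ x * x + 2 * x * y + y * y + 3 * x + y
  normalise = solve-∀
  doubled : (tri (x + y) + x) * 2 ≡ x * x + 2 * x * y + y * y + 3 * x + y
  doubled = begin
    (tri (x + y) + x) * 2          ≡⟨ *-distribʳ-+ 2 (tri (x + y)) x ⟩
    tri (x + y) * 2 + x * 2        ≡⟨ cong (_+ x * 2) (tri-double (x + y)) ⟩
    (x + y) * suc (x + y) + x * 2  ≡⟨ normalise x y ⟩
    x * x + 2 * x * y + y * y + 3 * x + y ∎

next : ℕ × ℕ → ℕ × ℕ
next (x , zero)  = (zero , suc x)
next (x , suc y) = (suc x , y)

unpair : ℕ → ℕ × ℕ
unpair zero    = (zero , zero)
unpair (suc z) = next (unpair z)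

unpair-tri : ∀ n x → x ≤ n → unpair (tri n + x) ≡ (x , n ∸ x)
unpair-tri zero    zero    _ = refl
unpair-tri (suc n) zero    _
  rewrite +-identityʳ (tri n + suc n) | +-suc (tri n) n
        | unpair-tri n n ≤-refl | n∸n≡0 n = refl
unpair-tri n       (suc x) x<n
  rewrite +-suc (tri n) x | unpair-tri n x (≤-trans (n≤1+n x) x<n)
        | +-∸-assoc 1 x<n = refl

unpair-pair : ∀ x y → unpair ⟨ x , y ⟩ ≡ (x , y)
unpair-pair x y
  rewrite pair-tri x y | unpair-tri (x + y) x (m≤m+n x y) | m+n∸m≡n x y = refl

decode : ∀ k → ℕ → Vec ℕ (suc k)
decode zero    z = z ∷ []
decode (suc k) z = decode k (proj₁ (unpair z)) ∷ʳ proj₂ (unpair z)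

code-∷ʳ : ∀ {k} (xs : Vec ℕ (suc k)) y → code (xs ∷ʳ y) ≡ ⟨ code xs , y ⟩
code-∷ʳ (x ∷ xs) y = trans (cong (foldl ⟨_,_⟩ x) (toList-∷ʳ y xs))
                           (foldl-∷ʳ ⟨_,_⟩ x y (toList xs))

decode-code : ∀ k (v : Vec ℕ (suc k)) → decode k (code v) ≡ v
decode-code zero    (x ∷ []) = refl
decode-code (suc k) v with initLast v
... | ys , y , refl = begin
  decode (suc k) (code (ys ∷ʳ y))   ≡⟨ cong (decode (suc k)) (code-∷ʳ ys y) ⟩
  decode (suc k) ⟨ code ys , y ⟩    ≡⟨ cong (λ p → decode k (proj₁ p) ∷ʳ proj₂ p)
                                            (unpair-pair (code ys) y) ⟩
  decode k (code ys) ∷ʳ y           ≡⟨ cong (_∷ʳ y) (decode-code k ys) ⟩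
  ys ∷ʳ y                           ∎
  where open ≡-Reasoning

π : ∀ k → Fin (suc k) → ℕ → ℕ
π k i t = lookup (decode k t) i

π-isProjection : ∀ k i → IsProjection k i (π k i)
π-isProjection k i xs = cong (λ v → lookup v i) (decode-code k xs)

-- Distinct indices give extensionally distinct projections: evaluate both
-- at the code of the sequence 0, 1, …, k.
π-injective : ∀ k (i j : Fin (suc k)) → π k i ≐ π k j → i ≡ j
π-injective k i j π-i≐π-j = toℕ-injective (begin
  toℕ i                 ≡⟨ sym (π-at-probe i) ⟩
  π k i (code probe)    ≡⟨ π-i≐π-j (code probe) ⟩
  π k j (code probe)    ≡⟨ π-at-probe j ⟩
  toℕ j                 ∎)
  where
  open ≡-Reasoning
  probe : Vec ℕ (suc k)
  probe = tabulate toℕ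
  π-at-probe : ∀ l → π k l (code probe) ≡ toℕ l
  π-at-probe l = trans (π-isProjection k l probe) (lookup∘tabulate toℕ l)

Elements : (ℕ → Bool) → Set
Elements P = Σ ℕ (T ∘ P)

elements-≡ : ∀ {P : ℕ → Bool} {s t : Elements P} → proj₁ s ≡ proj₁ t → s ≡ t
elements-≡ refl = Σ-≡,≡→≡ (refl , T-irrelevant _ _)

module Image (P : ℕ → Bool) (e h : ℕ → ℕ) (h∘e : ∀ s → h (e s) ≡ s) where

  image : ℕ → Bool
  image t = P (h t) ∧ (e (h t) ≡ᵇ t)

  e-image : ∀ {s} → T (P s) → T (image (e s))
  e-image {s} s∈P rewrite h∘e s = Equivalence.from T-∧ (s∈P , ≡⇒≡ᵇ (e s) (e s) refl)

  into : Elements P → Elements image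
  into (s , s∈P) = e s , e-image s∈P

  back : Elements image → Elements P
  back (t , t∈image) = h t , proj₁ (Equivalence.to T-∧ t∈image)

  into∘back : ∀ t → into (back t) ≡ t
  into∘back (t , t∈image) =
    elements-≡ (≡ᵇ⇒≡ _ _ (proj₂ (Equivalence.to T-∧ t∈image)))

  back∘into : ∀ s → back (into s) ≡ s
  back∘into (s , _) = elements-≡ (h∘e s)

  image-⤖ : Elements P ⤖ Elements image
  image-⤖ = ↔⇒⤖ (mk↔ₛ′ into back into∘back back∘into)

module ProjectionModel (M : Model) (n : ℕ) (f : Obs M ⤖ Fin n) where

  index : Obs M → Fin n
  index = Bijection.to f

  listing : Fin n → Obs M
  listing = Inverse.from (⤖⇒↔ f)

  listing-index : ∀ α → listing (index α) ≡ α
  listing-index = Inverse.strictlyInverseʳ (⤖⇒↔ f)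

  observations : ℕ → Vec ℕ (suc n)
  observations s = s ∷ tabulate (λ i → obs M (listing i) s)

  encode : ℕ → ℕ
  encode = code ∘ observations

  -- The state is the first entry of its record, so `encode` is injective.
  first-encode : ∀ s → π n fzero (encode s) ≡ s
  first-encode s = π-isProjection n fzero (observations s)

  projection : Fin n → ℕ → ℕ
  projection i = π n (fsuc i)

  projection-injective : ∀ i j → projection i ≐ projection j → i ≡ j
  projection-injective i j eq = suc-injective (π-injective n (fsuc i) (fsuc j) eq)

  open Image (S M) encode (π n fzero) first-encode using (image; image-⤖)

  N : Model
  N = record { S = image ; Obs = Fin n ; obs = projection ; obs-inj = projection-injective }

  compat : (α : Obs M) (s : State M) →
           obs M α (proj₁ s) ≡ projection (index α) (encode (proj₁ s))
  compat α (s , _) = sym (begin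
    π n (fsuc (index α)) (code (observations s))
      ≡⟨ π-isProjection n (fsuc (index α)) (observations s) ⟩
    lookup (tabulate (λ i → obs M (listing i) s)) (index α)
      ≡⟨ lookup∘tabulate (λ i → obs M (listing i) s) (index α) ⟩
    obs M (listing (index α)) s
      ≡⟨ cong (λ β → obs M β s) (listing-index α) ⟩
    obs M α s ∎)
    where open ≡-Reasoning

  M≅N : M ≅ N
  M≅N = record { φ = image-⤖ ; ψ = f ; compat = compat }

theorem1 : (M : Model) → FiniteObs M → ∃ λ N → (M ≅ N) × AllProjections N
theorem1 M (n , f) = N , M≅N , n , λ i → fsuc i , π-isProjection n (fsuc i)
  where open ProjectionModel M n f
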